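{- For every constant $\varepsilon>0$ there exists an integer $k(\varepsilon)$ such that for every $k\ge k(\varepsilon)$ and every $n\ge k$ there exists a $k$-junta $f:\mathbb{Z}_2^n\to\mathbb{Z}_2$ which is not $q$-locally correctable for $\varepsilon$, for any number of queries $q$.
   Context: For $f:\mathbb{Z}_2^n\to\mathbb{Z}_2$ and a permutation $\sigma\in\mathcal{S}_n$, let $f_\sigma(x_1,\dots,x_n)=f(x_{\sigma(1)},\dots,x_{\sigma(n)})$; such an $f_\sigma$ is called an isomorphism of $f$. Two functions $f,g:\mathbb{Z}_2^n\to\mathbb{Z}_2$ are $\varepsilon$-close if $\Pr_x[f(x)\ne g(x)]\le\varepsilon$ for uniformly random $x\in\mathbb{Z}_2^n$. Local correction: $f$ (known to the algorithm) is $q$-locally correctable for $\varepsilon>0$ if there is a randomized algorithm which, for every $\sigma\in\mathcal{S}_n$, every $g$ that is $\varepsilon$-close to $f_\sigma$, and every $x\in\mathbb{Z}_2^n$, given $x$ and black-box (query) access to $g$ (but not $\sigma$), outputs $f_\sigma(x)$ with probability at least $2/3$ using at most $q$ queries to $g$. A $k$-junta is a function depending only on (at most) $k$ of its input variables. -}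

module Defs where

open import Algebra.Bundles using (CommutativeMonoid)
open import Data.Bool using (Bool; true; false; if_then_else_)
import Data.Bool.Properties as Bool
open import Data.Fin using (Fin)
open import Data.Fin.Permutation using (Permutation′; _⟨$⟩ʳ_)
open import Data.Fin.Subset using (Subset; _∈_; ∣_∣)
open import Data.Integer using (+_)
open import Data.List using (List; []; _∷_; map; _++_; length; filter)
open import Data.Nat as ℕ using (ℕ; zero; suc; _^_)
import Data.Nat.Properties as ℕ
import Data.Nat.Tactic.RingSolver as ℕSolver
open import Data.Product using (Σ-syntax; _×_)
open import Data.Rational as ℚ using (ℚ; 0ℚ; 1ℚ; _/_)
import Data.Rational.Properties as ℚ
open import Algebra.Properties.CommutativeSemigroup (CommutativeMonoid.commutativeSemigroup ℚ.+-0-commutativeMonoid) using (interchange)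
import Data.Rational.Unnormalised as ℚᵘ
import Data.Rational.Unnormalised.Properties as ℚᵘ
open import Data.Vec using (Vec; []; _∷_; lookup; tabulate)
open import Data.Vec.Functional using (foldr)
open import Relation.Binary.PropositionalEquality using (_≡_; cong; cong₂)
open import Relation.Nullary using (¬?; does)

-- Real numbers in the style of Bishop: a real is a regular sequence of
-- rationals, its n-th term being within 1/(n+1) of the limit.

recip : ℕ → ℚ
recip n = + 1 / suc n

record ℝ : Set where
  constructor mkℝ
  field
    seq     : ℕ → ℚ
    regular : ∀ m n → ℚ.∣ seq m ℚ.- seq n ∣ ℚ.≤ recip m ℚ.+ recip n

open ℝ public

infix  4 _≤ℝ_ _<ℝ_ _≃ℝ_
infixl 6 _+ℝ_

-- The slack 2/(n+1) is the sum of the errors of the two n-th terms.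

data _≤ℝ_ (x y : ℝ) : Set where
  mk≤ : (∀ n → seq x n ℚ.≤ seq y n ℚ.+ (recip n ℚ.+ recip n)) → x ≤ℝ y

data _<ℝ_ (x y : ℝ) : Set where
  mk< : ∀ n → seq x n ℚ.+ (recip n ℚ.+ recip n) ℚ.< seq y n → x <ℝ y

_≃ℝ_ : ℝ → ℝ → Set
x ≃ℝ y = x ≤ℝ y × y ≤ℝ x

recip-nonNeg : ∀ n → 0ℚ ℚ.≤ recip n
recip-nonNeg n = ℚ.nonNegative⁻¹ (recip n) {{ℚ.normalize-nonNeg 1 (suc n)}}

-- The regularity proofs are abstract only to keep them from being normalised.

abstract
  const-regular : ∀ p m n → ℚ.∣ p ℚ.- p ∣ ℚ.≤ recip m ℚ.+ recip n
  const-regular p m n = begin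
    ℚ.∣ p ℚ.- p ∣       ≡⟨ cong ℚ.∣_∣ (ℚ.+-inverseʳ p) ⟩
    0ℚ ℚ.+ 0ℚ           ≤⟨ ℚ.+-mono-≤ (recip-nonNeg m) (recip-nonNeg n) ⟩
    recip m ℚ.+ recip n ∎
    where open ℚ.≤-Reasoning

fromℚ : ℚ → ℝ
fromℚ p = mkℝ (λ _ → p) (const-regular p)

0ℝ 1ℝ : ℝ
0ℝ = fromℚ 0ℚ
1ℝ = fromℚ 1ℚ

double : ℕ → ℕ
double n = suc (n ℕ.+ n)

recip-double : ∀ n → recip (double n) ℚ.+ recip (double n) ≡ recip n
recip-double n = ℚ.toℚᵘ-injective (begin-equality
  ℚ.toℚᵘ (recip (double n) ℚ.+ recip (double n))
    ≃⟨ ℚ.toℚᵘ-homo-+ (recip (double n)) (recip (double n)) ⟩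
  ℚ.toℚᵘ (recip (double n)) ℚᵘ.+ ℚ.toℚᵘ (recip (double n))
    ≃⟨ ℚᵘ.+-cong (ℚ.toℚᵘ-fromℚᵘ u) (ℚ.toℚᵘ-fromℚᵘ u) ⟩
  u ℚᵘ.+ u
    ≃⟨ ℚᵘ.*≡* (cong +_ (arith n)) ⟩
  ℚᵘ.mkℚᵘ (+ 1) n
    ≃⟨ ℚ.toℚᵘ-fromℚᵘ (ℚᵘ.mkℚᵘ (+ 1) n) ⟨
  ℚ.toℚᵘ (recip n) ∎)
  where
  open ℚᵘ.≤-Reasoning
  u = ℚᵘ.mkℚᵘ (+ 1) (double n)
  arith : ∀ n → (1 ℕ.* suc (suc (n ℕ.+ n)) ℕ.+ 1 ℕ.* suc (suc (n ℕ.+ n))) ℕ.* suc n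
              ≡ 1 ℕ.* (suc (suc (n ℕ.+ n)) ℕ.* suc (suc (n ℕ.+ n)))
  arith = ℕSolver.solve-∀

∣+-+∣-bound : ∀ a b c d r s → ℚ.∣ a ℚ.- c ∣ ℚ.≤ r ℚ.+ s → ℚ.∣ b ℚ.- d ∣ ℚ.≤ r ℚ.+ s →
              ℚ.∣ (a ℚ.+ b) ℚ.- (c ℚ.+ d) ∣ ℚ.≤ (r ℚ.+ r) ℚ.+ (s ℚ.+ s)
∣+-+∣-bound a b c d r s p q = begin
  ℚ.∣ (a ℚ.+ b) ℚ.- (c ℚ.+ d) ∣       ≡⟨ cong (λ t → ℚ.∣ (a ℚ.+ b) ℚ.+ t ∣) (ℚ.neg-distrib-+ c d) ⟩
  ℚ.∣ (a ℚ.+ b) ℚ.+ (ℚ.- c ℚ.- d) ∣   ≡⟨ cong ℚ.∣_∣ (interchange a b (ℚ.- c) (ℚ.- d)) ⟩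
  ℚ.∣ (a ℚ.- c) ℚ.+ (b ℚ.- d) ∣       ≤⟨ ℚ.∣p+q∣≤∣p∣+∣q∣ (a ℚ.- c) (b ℚ.- d) ⟩
  ℚ.∣ a ℚ.- c ∣ ℚ.+ ℚ.∣ b ℚ.- d ∣     ≤⟨ ℚ.+-mono-≤ p q ⟩
  (r ℚ.+ s) ℚ.+ (r ℚ.+ s)             ≡⟨ interchange r s r s ⟩
  (r ℚ.+ r) ℚ.+ (s ℚ.+ s)             ∎
  where open ℚ.≤-Reasoning

abstract
  +ℝ-regular : ∀ x y m n →
    ℚ.∣ (seq x (double m) ℚ.+ seq y (double m)) ℚ.- (seq x (double n) ℚ.+ seq y (double n)) ∣
      ℚ.≤ recip m ℚ.+ recip n
  +ℝ-regular x y m n = ℚ.≤-trans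
    (∣+-+∣-bound (seq x (double m)) (seq y (double m)) (seq x (double n)) (seq y (double n))
      (recip (double m)) (recip (double n))
      (regular x (double m) (double n)) (regular y (double m) (double n)))
    (ℚ.≤-reflexive (cong₂ ℚ._+_ (recip-double m) (recip-double n)))

_+ℝ_ : ℝ → ℝ → ℝ
x +ℝ y = mkℝ (λ n → seq x (double n) ℚ.+ seq y (double n)) (+ℝ-regular x y)

∑ : ∀ {m} → (Fin m → ℝ) → ℝ
∑ = foldr _+ℝ_ 0ℝ

-- Only the underlying set {0,1} of ℤ₂ matters, so it is taken to be Bool.

Cube : ℕ → Set
Cube n = Vec Bool n

BoolFun : ℕ → Set
BoolFun n = Cube n → Bool

cube : ∀ n → List (Cube n)
cube zero    = [] ∷ []
cube (suc n) = map (false ∷_) (cube n) ++ map (true ∷_) (cube n)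

isomorphism : ∀ {n} → BoolFun n → Permutation′ n → BoolFun n
isomorphism f σ x = f (tabulate λ i → lookup x (σ ⟨$⟩ʳ i))

Pr[_≢_] : ∀ {n} → BoolFun n → BoolFun n → ℚ
Pr[_≢_] {n} f g = + length (filter (λ x → ¬? (f x Bool.≟ g x)) (cube n)) / 2 ^ n
  where instance _ = ℕ.m^n≢0 2 n

Close : ∀ {n} → ℝ → BoolFun n → BoolFun n → Set
Close ε f g = fromℚ Pr[ f ≢ g ] ≤ℝ ε

IsJunta : ∀ {n} → ℕ → BoolFun n → Set
IsJunta {n} k f = Σ[ S ∈ Subset n ] ∣ S ∣ ℕ.≤ k ×
  (∀ x y → (∀ i → i ∈ S → lookup x i ≡ lookup y i) → f x ≡ f y)

-- Deterministic adaptive algorithms making at most q queries to an oracle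
-- Cube n → Bool, as decision trees.

data DecisionTree (n : ℕ) : ℕ → Set where
  output : ∀ {q} → Bool → DecisionTree n q
  query  : ∀ {q} → Cube n → (Bool → DecisionTree n q) → DecisionTree n (suc q)

run : ∀ {n q} → DecisionTree n q → BoolFun n → Bool
run (output b)  g = b
run (query y t) g = run (t (g y)) g

-- A randomized algorithm is a probability distribution on deterministic ones.
-- Up to pointwise equality there are only finitely many decision trees for given
-- n and q, so a finite index set with arbitrary real weights loses no generality.

record RandomizedTree (n q : ℕ) : Set where
  field
    size     : ℕ
    tree     : Fin size → DecisionTree n q
    weight   : Fin size → ℝ
    weight≥0 : ∀ i → 0ℝ ≤ℝ weight i
    total    : ∑ weight ≃ℝ 1ℝ

Pr[_on_outputs_] : ∀ {n q} → RandomizedTree n q → BoolFun n → Bool → ℝ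
Pr[ A on g outputs b ] =
  ∑ λ i → if does (run (tree i) g Bool.≟ b) then weight i else 0ℝ
  where open RandomizedTree A

-- The algorithm may depend on f and sees the point x; σ is hidden from it,
-- and g is accessible only through queries.

LocallyCorrectable : ∀ {n} → ℕ → ℝ → BoolFun n → Set
LocallyCorrectable {n} q ε f =
  Σ[ A ∈ (Cube n → RandomizedTree n q) ]
    ∀ (σ : Permutation′ n) (g : BoolFun n) → Close ε g (isomorphism f σ) →
    ∀ (x : Cube n) → fromℚ (+ 2 / 3) ≤ℝ Pr[ A x on g outputs isomorphism f σ x ]

{-# OPTIONS --safe #-}
module Submission where

-- Let f test whether the first k bits are 1,0,…,0, and let τ swap the first
-- two coordinates. Both f and f_τ are true on only a 2⁻ᵏ fraction of the cube,
-- so the constant function false is ε-close to both once 2⁻ᵏ is small. On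
-- x = (1,0,…,0) they differ, hence an algorithm given the oracle false would
-- have to answer both true and false at x, each with probability at least 2/3.

open import Defs
open import Algebra.Bundles using (CommutativeMonoid)
open import Data.Bool using (Bool; true; false; not; _∧_; if_then_else_)
import Data.Bool.Properties as Bool
open import Data.Fin using (Fin; zero; suc)
open import Data.Fin.Permutation using (Permutation′; id; swap)
open import Data.Fin.Subset using (Subset; inside; outside; ∣_∣; _∈_)
open import Data.Integer as ℤ using (+_; -[1+_])
import Data.Integer.Properties as ℤ
open import Data.List using (List; []; _∷_; _++_; length; filter; map)
import Data.List.Properties as List
import Data.List.Relation.Binary.Sublist.Propositional as Sublist
import Data.List.Relation.Binary.Sublist.Propositional.Properties as Sublist
open import Data.List.Relation.Unary.All using (universal)
open import Data.Nat using (ℕ; zero; suc; NonZero; _+_; _*_; _^_; _≤_; _<_; z≤n; s≤s)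
import Data.Nat.Properties as ℕ
import Data.Nat.Tactic.RingSolver as ℕSolver
open import Data.Product using (Σ-syntax; ∃-syntax; _×_; _,_; proj₁)
open import Data.Rational as ℚ using (mkℚ; 0ℚ; 1ℚ; _/_)
import Data.Rational.Properties as ℚ
open import Algebra.Properties.CommutativeSemigroup (CommutativeMonoid.commutativeSemigroup ℚ.+-0-commutativeMonoid) using (interchange)
open import Data.Rational.Solver using (module +-*-Solver)
import Data.Rational.Unnormalised as ℚᵘ
import Data.Rational.Unnormalised.Properties as ℚᵘ
open import Data.Vec using ([]; _∷_; lookup; replicate; tail; here; there)
import Data.Vec.Properties as Vec
open import Function using (_∘_; const)
open import Relation.Binary.PropositionalEquality using (_≡_; refl; sym; trans; cong; cong₂; subst; module ≡-Reasoning)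
open import Relation.Nullary using (¬_; ¬?; does)
open import Relation.Nullary.Decidable using (from-no)
open import Relation.Unary using (Decidable)

-- Counting the true points of a Boolean function.

count : ∀ {n} → BoolFun n → ℕ
count {n} f = length (filter (λ x → f x Bool.≟ true) (cube n))

length-filter-map : ∀ {A B : Set} {P : B → Set} (P? : Decidable P) (f : A → B) xs →
                    length (filter P? (map f xs)) ≡ length (filter (P? ∘ f) xs)
length-filter-map P? f []       = refl
length-filter-map P? f (x ∷ xs) with does (P? (f x))
... | true  = cong suc (length-filter-map P? f xs)
... | false = length-filter-map P? f xs

count-∷ : ∀ {n} (f : BoolFun (suc n)) →
          count f ≡ count (f ∘ (false ∷_)) + count (f ∘ (true ∷_))
count-∷ {n} f = begin
  length (filter P? (xs ++ ys))                   ≡⟨ cong length (List.filter-++ P? xs ys) ⟩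
  length (filter P? xs ++ filter P? ys)           ≡⟨ List.length-++ (filter P? xs) ⟩
  length (filter P? xs) + length (filter P? ys)   ≡⟨ cong₂ _+_ (length-filter-map P? _ (cube n))
                                                               (length-filter-map P? _ (cube n)) ⟩
  count (f ∘ (false ∷_)) + count (f ∘ (true ∷_))  ∎
  where
  open ≡-Reasoning
  P? = λ x → f x Bool.≟ true
  xs = map (false ∷_) (cube n)
  ys = map (true ∷_) (cube n)

count-mono : ∀ {n} {f g : BoolFun n} → (∀ x → f x ≡ true → g x ≡ true) → count f ≤ count g
count-mono {n} f⇒g = Sublist.length-mono-≤
  (Sublist.filter⁺ _ _ (λ { refl → f⇒g _ }) (Sublist.⊆-refl {x = cube n}))

count-false : ∀ n → count {n} (const false) ≡ 0
count-false n = cong length (List.filter-none (λ _ → false Bool.≟ true) (universal (λ _ ()) (cube n)))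

-- Each of the two halves of the cube contributes at most `count g`. This discards a leading
-- coordinate at the price of a factor 2.
count-≤-∷ : ∀ {n} (f : BoolFun (suc n)) (g : BoolFun n) →
            (∀ b x → f (b ∷ x) ≡ true → g x ≡ true) → count f ≤ 2 * count g
count-≤-∷ f g f⇒g = begin
  count f                                         ≡⟨ count-∷ f ⟩
  count (f ∘ (false ∷_)) + count (f ∘ (true ∷_))  ≤⟨ ℕ.+-mono-≤ (count-mono (f⇒g false)) (count-mono (f⇒g true)) ⟩
  count g + count g                               ≡⟨ cong (λ c → count g + c) (ℕ.+-identityʳ (count g)) ⟨
  2 * count g                                     ∎
  where open ℕ.≤-Reasoning

count≤2^n : ∀ {n} (f : BoolFun n) → count f ≤ 2 ^ n
count≤2^n {zero}  f = List.length-filter (λ x → f x Bool.≟ true) (cube zero)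
count≤2^n {suc n} f = ℕ.≤-trans (count-≤-∷ f (const true) (λ _ _ _ → refl))
                                (ℕ.*-monoʳ-≤ 2 (count≤2^n {n} (const true)))

-- The junta, its two isomorphisms and the density of their true points.

zeros : ℕ → ∀ {n} → BoolFun n
zeros zero    xs       = true
zeros (suc k) []       = true
zeros (suc k) (x ∷ xs) = not x ∧ zeros k xs

count-zeros : ∀ {k n} → k ≤ n → count (zeros k {n}) * 2 ^ k ≤ 2 ^ n
count-zeros {n = n} z≤n = ℕ.≤-trans (ℕ.≤-reflexive (ℕ.*-identityʳ _)) (count≤2^n {n} (const true))
count-zeros {suc k} {suc n} (s≤s k≤n) = begin
  count (zeros (suc k) {suc n}) * 2 ^ suc k       ≡⟨ cong (_* 2 ^ suc k) (count-∷ (zeros (suc k) {suc n})) ⟩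
  -- On the half of the cube starting with `true`, `zeros (suc k)` computes to `false`; the other
  -- half is the case `k`.
  (c + count {n} (const false)) * 2 ^ suc k       ≡⟨ cong (λ d → (c + d) * 2 ^ suc k) (count-false n) ⟩
  (c + 0) * (2 * 2 ^ k)                           ≡⟨ arith c (2 ^ k) ⟩
  2 * (c * 2 ^ k)                                 ≤⟨ ℕ.*-monoʳ-≤ 2 (count-zeros k≤n) ⟩
  2 ^ suc n                                       ∎
  where
  open ℕ.≤-Reasoning
  c = count (zeros k {n})
  arith : ∀ c p → (c + 0) * (2 * p) ≡ 2 * (c * p)
  arith = ℕSolver.solve-∀

-- Here `k` counts only the bits tested after the leading 1,0, so `2 + k` bits are tested in all.
pattern10⋯0 : ℕ → ∀ {n} → BoolFun (2 + n)
pattern10⋯0 k (x ∷ y ∷ zs) = x ∧ not y ∧ zeros k zs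

firstCoords : ℕ → ∀ n → Subset n
firstCoords k       zero    = []
firstCoords zero    (suc n) = outside ∷ firstCoords zero n
firstCoords (suc k) (suc n) = inside ∷ firstCoords k n

∣firstCoords∣≤ : ∀ k n → ∣ firstCoords k n ∣ ≤ k
∣firstCoords∣≤ k       zero    = z≤n
∣firstCoords∣≤ zero    (suc n) = ∣firstCoords∣≤ zero n
∣firstCoords∣≤ (suc k) (suc n) = s≤s (∣firstCoords∣≤ k n)

zeros-cong : ∀ k {n} (xs ys : Cube n) →
             (∀ i → i ∈ firstCoords k n → lookup xs i ≡ lookup ys i) → zeros k xs ≡ zeros k ys
zeros-cong zero    xs       ys       agree = refl
zeros-cong (suc k) []       []       agree = refl
zeros-cong (suc k) (x ∷ xs) (y ∷ ys) agree =
  cong₂ (λ b c → not b ∧ c) (agree zero here) (zeros-cong k xs ys (λ i i∈S → agree (suc i) (there i∈S)))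

pattern10⋯0-junta : ∀ k n → IsJunta (2 + k) (pattern10⋯0 k {n})
pattern10⋯0-junta k n = firstCoords (2 + k) (2 + n) , ∣firstCoords∣≤ (2 + k) (2 + n) ,
  λ { (x ∷ y ∷ zs) (x′ ∷ y′ ∷ zs′) agree →
      cong₂ _∧_ (agree zero here)
        (cong₂ (λ b c → not b ∧ c) (agree (suc zero) (there here))
          (zeros-cong k zs zs′ (λ i i∈S → agree (suc (suc i)) (there (there i∈S))))) }

isomorphism-id : ∀ {n} (f : BoolFun n) x → isomorphism f id x ≡ f x
isomorphism-id f x = cong f (Vec.tabulate∘lookup x)

isomorphism-swap : ∀ {n} (f : BoolFun (2 + n)) x y zs →
                   isomorphism f (swap id) (x ∷ y ∷ zs) ≡ f (y ∷ x ∷ zs)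
isomorphism-swap f x y zs = cong (λ t → f (y ∷ x ∷ t)) (Vec.tabulate∘lookup zs)

pattern10⋯0⇒zeros : ∀ k {n} x y (zs : Cube n) → pattern10⋯0 k (x ∷ y ∷ zs) ≡ true → zeros k zs ≡ true
pattern10⋯0⇒zeros k x y zs eq = Bool.∧-conicalʳ (not y) _ (Bool.∧-conicalʳ x _ eq)

zeros-replicate : ∀ k n → zeros k (replicate n false) ≡ true
zeros-replicate zero    n       = refl
zeros-replicate (suc k) zero    = refl
zeros-replicate (suc k) (suc n) = zeros-replicate k n

-- The hypothesis on `h` ignores the first two bits, so it is invariant under swapping them and one
-- bound serves both isomorphisms. Discarding these bits costs a factor 4, exactly the ratio of
-- `2 ^ (2 + n)` to `2 ^ n`.
count-⇒zeros : ∀ k {n} → k ≤ n → (h : BoolFun (2 + n)) →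
                    (∀ x y zs → h (x ∷ y ∷ zs) ≡ true → zeros k zs ≡ true) →
                    count h * 2 ^ k ≤ 2 ^ (2 + n)
count-⇒zeros k {n} k≤n h h⇒zeros = begin
  count h * 2 ^ k            ≤⟨ ℕ.*-monoˡ-≤ (2 ^ k) (count-≤-∷ h zeros-tail λ { x (y ∷ zs) → h⇒zeros x y zs }) ⟩
  2 * count zeros-tail * 2 ^ k
                             ≤⟨ ℕ.*-monoˡ-≤ (2 ^ k) (ℕ.*-monoʳ-≤ 2 (count-≤-∷ zeros-tail (zeros k) λ _ _ eq → eq)) ⟩
  2 * (2 * c) * 2 ^ k        ≡⟨ arith c (2 ^ k) ⟩
  2 * (2 * (c * 2 ^ k))      ≤⟨ ℕ.*-monoʳ-≤ 2 (ℕ.*-monoʳ-≤ 2 (count-zeros k≤n)) ⟩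
  2 ^ (2 + n)                ∎
  where
  open ℕ.≤-Reasoning
  zeros-tail : BoolFun (suc n)
  zeros-tail = zeros k ∘ tail
  c = count (zeros k {n})
  arith : ∀ c p → 2 * (2 * c) * p ≡ 2 * (2 * (c * p))
  arith = ℕSolver.solve-∀

-- From counts to closeness for a real `ε`.

n<2^n : ∀ n → n < 2 ^ n
n<2^n zero    = s≤s z≤n
n<2^n (suc n) = ℕ.≤-trans (s≤s (n<2^n n)) (ℕ.^-monoʳ-< 2 (s≤s (s≤s z≤n)) (ℕ.n<1+n n))

-- Since `_/_` reduces to lowest terms, the comparison is made on unnormalised rationals, where it
-- is cross-multiplication. `d` is kept general because it will be `2 ^ n`, which is not
-- syntactically a successor.
/-≤-recip : ∀ a d N .{{_ : NonZero d}} → a * suc N ≤ d → + a / d ℚ.≤ recip N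
/-≤-recip a (suc d) N a*N≤d = ℚ.toℚᵘ-cancel-≤ (begin
  ℚ.toℚᵘ (+ a / suc d)  ≃⟨ ℚ.toℚᵘ-fromℚᵘ (ℚᵘ.mkℚᵘ (+ a) d) ⟩
  ℚᵘ.mkℚᵘ (+ a) d       ≤⟨ ℚᵘ.*≤* numerators ⟩
  ℚᵘ.mkℚᵘ (+ 1) N       ≃⟨ ℚ.toℚᵘ-fromℚᵘ (ℚᵘ.mkℚᵘ (+ 1) N) ⟨
  ℚ.toℚᵘ (recip N)      ∎)
  where
  open ℚᵘ.≤-Reasoning
  numerators : + a ℤ.* + suc N ℤ.≤ + 1 ℤ.* + suc d
  numerators rewrite ℤ.*-identityˡ (+ suc d) | sym (ℤ.pos-* a (suc N)) = ℤ.+≤+ a*N≤d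

p≤∣p∣ : ∀ p → p ℚ.≤ ℚ.∣ p ∣
p≤∣p∣ (mkℚ (+ n)    _ _) = ℚ.≤-refl
p≤∣p∣ (mkℚ -[1+ n ] _ _) = ℚ.*≤* ℤ.-≤+

private
  open +-*-Solver

  p≡0+[p+p]-p : ∀ p → p ≡ (0ℚ ℚ.+ (p ℚ.+ p)) ℚ.- p
  p≡0+[p+p]-p = solve 1 (λ p → p := (con 0ℚ :+ (p :+ p)) :- p) refl

  p-r≡[p-q]+[q-r] : ∀ p q r → p ℚ.- r ≡ (p ℚ.- q) ℚ.+ (q ℚ.- r)
  p-r≡[p-q]+[q-r] = solve 3 (λ p q r → p :- r := (p :- q) :+ (q :- r)) refl

  [p+q]+[r-p]≡r+[0+q] : ∀ p q r → (p ℚ.+ q) ℚ.+ (r ℚ.- p) ≡ r ℚ.+ (0ℚ ℚ.+ q)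
  [p+q]+[r-p]≡r+[0+q] = solve 3 (λ p q r → (p :+ q) :+ (r :- p) := r :+ (con 0ℚ :+ q)) refl

-- x_N > 2/(N+1) forces x > 1/(N+1), because x_N is within 1/(N+1) of x.

recip≤ℝ : ∀ x N → 0ℚ ℚ.+ (recip N ℚ.+ recip N) ℚ.< seq x N → fromℚ (recip N) ≤ℝ x
recip≤ℝ x N 2r<xN = mk≤ λ m → begin
  r                                                   ≡⟨ p≡0+[p+p]-p r ⟩
  (0ℚ ℚ.+ (r ℚ.+ r)) ℚ.- r                            ≤⟨ ℚ.+-monoˡ-≤ (ℚ.- r) (ℚ.<⇒≤ 2r<xN) ⟩
  seq x N ℚ.- r                                       ≡⟨ p-r≡[p-q]+[q-r] (seq x N) (seq x m) r ⟩
  (seq x N ℚ.- seq x m) ℚ.+ (seq x m ℚ.- r)           ≤⟨ ℚ.+-monoˡ-≤ (seq x m ℚ.- r) (ℚ.≤-trans (p≤∣p∣ _) (regular x N m)) ⟩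
  (r ℚ.+ recip m) ℚ.+ (seq x m ℚ.- r)                 ≡⟨ [p+q]+[r-p]≡r+[0+q] r (recip m) (seq x m) ⟩
  seq x m ℚ.+ (0ℚ ℚ.+ recip m)                        ≤⟨ ℚ.+-monoʳ-≤ (seq x m) (ℚ.+-monoˡ-≤ (recip m) (recip-nonNeg m)) ⟩
  seq x m ℚ.+ (recip m ℚ.+ recip m)                   ∎
  where
  open ℚ.≤-Reasoning
  r = recip N

disagreements : ∀ {n} → BoolFun n → BoolFun n → List (Cube n)
disagreements {n} g h = filter (λ x → ¬? (g x Bool.≟ h x)) (cube n)

length-disagreements-false : ∀ {n} (h : BoolFun n) → length (disagreements (const false) h) ≤ count h
length-disagreements-false {n} h = Sublist.length-mono-≤
  (Sublist.filter⁺ (λ x → ¬? (false Bool.≟ h x)) (λ x → h x Bool.≟ true)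
    (λ { refl false≢h → Bool.¬-not (false≢h ∘ sym) }) (Sublist.⊆-refl {x = cube n}))

Pr-≤-recip : ∀ {n} (g h : BoolFun n) N → length (disagreements g h) * suc N ≤ 2 ^ n → Pr[ g ≢ h ] ℚ.≤ recip N
Pr-≤-recip {n} g h N bound = /-≤-recip (length (disagreements g h)) (2 ^ n) N bound
  where instance _ = ℕ.m^n≢0 2 n

fromℚ-≤-trans : ∀ {p q x} → p ℚ.≤ q → fromℚ q ≤ℝ x → fromℚ p ≤ℝ x
fromℚ-≤-trans p≤q (mk≤ q≤x) = mk≤ λ n → ℚ.≤-trans p≤q (q≤x n)

-- The first hypothesis is the content of a witness of `0ℝ <ℝ ε`. It places `ε` above 1/(N+1), and
-- the second keeps the fraction of true points of `h` at or below that.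
close-false : ∀ {n} ε N (h : BoolFun n) → 0ℚ ℚ.+ (recip N ℚ.+ recip N) ℚ.< seq ε N →
              count h * suc N ≤ 2 ^ n → Close ε (const false) h
close-false ε N h 2r<εN bound = fromℚ-≤-trans
  (Pr-≤-recip (const false) h N
    (ℕ.≤-trans (ℕ.*-monoˡ-≤ (suc N) (length-disagreements-false h)) bound))
  (recip≤ℝ ε N 2r<εN)

-- Two answers to the same oracle.

-- The two sums and the total are all read off at the same indices of their
-- terms, so the equation holds exactly in ℚ and not only up to ≃ℝ.

∑-seq-+ : ∀ {m} (u v w : Fin m → ℝ) → (∀ i n → seq (u i) n ℚ.+ seq (v i) n ≡ seq (w i) n) →
          ∀ n → seq (∑ u) n ℚ.+ seq (∑ v) n ≡ seq (∑ w) n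
∑-seq-+ {zero}  u v w u+v≡w n = refl
∑-seq-+ {suc m} u v w u+v≡w n = trans
  (interchange (seq (u zero) (double n)) (seq (∑ (u ∘ suc)) (double n))
               (seq (v zero) (double n)) (seq (∑ (v ∘ suc)) (double n)))
  (cong₂ ℚ._+_ (u+v≡w zero (double n)) (∑-seq-+ (u ∘ suc) (v ∘ suc) (w ∘ suc) (u+v≡w ∘ suc) (double n)))

-- A tree gives exactly one of the two answers, so its weight enters one sum and `0ℝ` enters the
-- other.
if-seq-+ : ∀ b x n →
  seq (if does (b Bool.≟ true) then x else 0ℝ) n ℚ.+ seq (if does (b Bool.≟ false) then x else 0ℝ) n ≡ seq x n
if-seq-+ true  x n = ℚ.+-identityʳ (seq x n)
if-seq-+ false x n = ℚ.+-identityˡ (seq x n)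

-- At index n the hypotheses give 4/3 ≤ 1 + 6/(n+1), which fails for every n > 17.

no-two-thirds-each : ∀ {x y z} → (∀ n → seq x n ℚ.+ seq y n ≡ seq z n) → z ≤ℝ 1ℝ →
                     fromℚ (+ 2 / 3) ≤ℝ x → ¬ fromℚ (+ 2 / 3) ≤ℝ y
no-two-thirds-each {x} {y} {z} x+y≡z (mk≤ z≤1) (mk≤ ⅔≤x) (mk≤ ⅔≤y) = from-no (lhs ℚ.≤? rhs) (begin
  lhs                                      ≤⟨ ℚ.+-mono-≤ (⅔≤x 99) (⅔≤y 99) ⟩
  (seq x 99 ℚ.+ δ) ℚ.+ (seq y 99 ℚ.+ δ)    ≡⟨ interchange (seq x 99) δ (seq y 99) δ ⟩
  (seq x 99 ℚ.+ seq y 99) ℚ.+ (δ ℚ.+ δ)    ≡⟨ cong (ℚ._+ (δ ℚ.+ δ)) (x+y≡z 99) ⟩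
  seq z 99 ℚ.+ (δ ℚ.+ δ)                   ≤⟨ ℚ.+-monoˡ-≤ (δ ℚ.+ δ) (z≤1 99) ⟩
  rhs                                      ∎)
  where
  open ℚ.≤-Reasoning
  δ = recip 99 ℚ.+ recip 99
  lhs = + 2 / 3 ℚ.+ + 2 / 3
  rhs = (1ℚ ℚ.+ δ) ℚ.+ (δ ℚ.+ δ)

-- The two probabilities add up to the total weight, which is at most `1ℝ`.
both-outputs-unlikely : ∀ {n q} (A : RandomizedTree n q) g →
  fromℚ (+ 2 / 3) ≤ℝ Pr[ A on g outputs true ] →
  ¬ fromℚ (+ 2 / 3) ≤ℝ Pr[ A on g outputs false ]
both-outputs-unlikely A g =
  no-two-thirds-each (∑-seq-+ _ _ weight λ i → if-seq-+ (run (tree i) g) (weight i)) (proj₁ total)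
  where open RandomizedTree A

-- The distribution of answers is determined by `A x` and `g`, hence is the same for `σ` and `τ`,
-- while correctness demands `true` for one and `false` for the other.
not-correctable : ∀ {n ε} (f g : BoolFun n) (σ τ : Permutation′ n) x →
  Close ε g (isomorphism f σ) → Close ε g (isomorphism f τ) →
  isomorphism f σ x ≡ true → isomorphism f τ x ≡ false →
  ∀ q → ¬ LocallyCorrectable q ε f
not-correctable f g σ τ x closeσ closeτ fσ≡true fτ≡false q (A , correct) =
  both-outputs-unlikely (A x) g
    (subst (λ b → fromℚ (+ 2 / 3) ≤ℝ Pr[ A x on g outputs b ]) fσ≡true (correct σ g closeσ x))
    (subst (λ b → fromℚ (+ 2 / 3) ≤ℝ Pr[ A x on g outputs b ]) fτ≡false (correct τ g closeτ x))

proposition1p3 : ∀ (ε : ℝ) → 0ℝ <ℝ ε →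
    ∃[ k₀ ] (∀ (k : ℕ) → k₀ ≤ k → ∀ (n : ℕ) → k ≤ n →
    Σ[ f ∈ BoolFun n ] (IsJunta k f × (∀ (q : ℕ) → ¬ LocallyCorrectable q ε f)))
-- `N` is the index at which `ε` is seen to be positive. Two coordinates carry the leading 1,0 and
-- at least `N` more are tested for zero; below, `k` and `n` are the given numbers less 2.
proposition1p3 ε (mk< N 2r<εN) = 2 + N ,
  λ { (suc (suc k)) (s≤s (s≤s N≤k)) (suc (suc n)) (s≤s (s≤s k≤n)) →
      let f = pattern10⋯0 k
          x₀ = true ∷ false ∷ replicate n false
      in f , pattern10⋯0-junta k n ,
         not-correctable f (const false) id (swap id) x₀
           (close N≤k k≤n (isomorphism f id) λ x y zs eq →
             pattern10⋯0⇒zeros k x y zs (trans (sym (isomorphism-id f (x ∷ y ∷ zs))) eq))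
           (close N≤k k≤n (isomorphism f (swap id)) λ x y zs eq →
             -- The swap exchanges only the two discarded bits, so `zs` is tested as before.
             pattern10⋯0⇒zeros k y x zs (trans (sym (isomorphism-swap f x y zs)) eq))
           (trans (isomorphism-id f x₀) (zeros-replicate k n))
           (isomorphism-swap f true false (replicate n false)) }
  where
  close : ∀ {k n} → N ≤ k → k ≤ n → (h : BoolFun (2 + n)) →
          (∀ x y zs → h (x ∷ y ∷ zs) ≡ true → zeros k zs ≡ true) → Close ε (const false) h
  close {k} N≤k k≤n h h⇒zeros = close-false ε N h 2r<εN
    -- The strict `n<2^n N` unfolds to `suc N ≤ 2 ^ N`, which gives the factor `suc N` required by
    -- `close-false`.
    (ℕ.≤-trans (ℕ.*-monoʳ-≤ (count h) (ℕ.≤-trans (n<2^n N) (ℕ.^-monoʳ-≤ 2 N≤k)))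
               (count-⇒zeros k k≤n h h⇒zeros))
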